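{- There is no function $f:\mathbb{N}\to\mathbb{N}$ such that $\operatorname{tw}(G\circ H)\leq f(\operatorname{tw}(G\boxtimes H))$ for all graphs $G$ and $H$.
   Context: All graphs are simple, finite and undirected. A tree-decomposition of a graph $G$ is a pair $(T,\beta)$ consisting of a tree $T$ and a function $\beta:V(T)\to 2^{V(G)}$ such that (i) for every $v\in V(G)$, the set $\{t\in V(T): v\in\beta(t)\}$ is non-empty and induces a connected subgraph of $T$; and (ii) for every edge $uv\in E(G)$ there is $t\in V(T)$ with $\{u,v\}\subseteq\beta(t)$. Its width is $\max_{t\in V(T)}|\beta(t)|-1$. The treewidth $\operatorname{tw}(G)$ is the minimum width of a tree-decomposition of $G$. The strong product $G\boxtimes H$ is the graph with vertex set $V(G)\times V(H)$, where $(g_1,h_1)(g_2,h_2)$ is an edge if and only if $g_1=g_2$ and $h_1h_2\in E(H)$; or $g_1g_2\in E(G)$ and $h_1=h_2$; or $g_1g_2\in E(G)$ and $h_1h_2\in E(H)$. The lexicographic product $G\circ H$ is the graph with vertex set $V(G)\times V(H)$, where $(g_1,h_1)(g_2,h_2)$ is an edge if and only if $g_1g_2\in E(G)$; or $g_1=g_2$ and $h_1h_2\in E(H)$. -}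

module Defs where

open import Data.Fin.Base using (Fin)
open import Data.Fin.Properties using (inj⇒≟; *↔×)
open import Data.Fin.Subset using (Subset; ∣_∣) renaming (_∈_ to _∈ₛ_)
open import Data.Integer.Base using (ℤ; +_; 1ℤ; _-_; _≤_)
open import Data.List.Base using (List; _∷_; _∷ʳ_; map; allFin)
open import Data.List.Extrema.Nat using (max)
open import Data.List.Relation.Unary.Linked using (Linked)
open import Data.List.Relation.Unary.Unique.Propositional using (Unique)
open import Data.Nat.Base using (ℕ; _*_)
open import Data.Product.Base using (_×_; _,_; ∃; ∃-syntax; proj₁; proj₂)
open import Data.Product.Function.NonDependent.Propositional using (_×-↔_)
open import Data.Sum.Base using (_⊎_; inj₁; inj₂)
open import Function.Bundles using (_↔_; Inverse)
open import Function.Construct.Composition using (_↔-∘_)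
open import Function.Construct.Symmetry using (↔-sym)
open import Function.Properties.Inverse using (↔⇒↣)
open import Level using (0ℓ)
open import Relation.Binary.Construct.Closure.ReflexiveTransitive using (Star)
open import Relation.Binary.Core using (Rel)
open import Relation.Binary.Definitions
  using (Decidable; DecidableEquality; Irreflexive; Symmetric)
open import Relation.Binary.PropositionalEquality.Core using (_≡_; refl; sym)
open import Relation.Nullary.Decidable using (_×-dec_; _⊎-dec_)
open import Relation.Nullary.Negation.Core using (¬_)

record Graph : Set₁ where
  field
    V          : Set
    order      : ℕ
    enum       : V ↔ Fin order
    Adj        : Rel V 0ℓ
    adj?       : Decidable Adj
    adj-sym    : Symmetric Adj
    adj-irrefl : Irreflexive _≡_ Adj

  index : V → Fin order
  index = Inverse.to enum

  vertices : List V
  vertices = map (Inverse.from enum) (allFin order)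

  _≟ᵥ_ : DecidableEquality V
  _≟ᵥ_ = inj⇒≟ (↔⇒↣ enum)

open Graph using (V)

-- 2^{V(G)}, with vertices identified with their indices so that the
-- library's subsets of Fin n and their cardinality apply.
VertexSet : Graph → Set
VertexSet G = Subset (Graph.order G)

Member : (G : Graph) → V G → VertexSet G → Set
Member G v B = Graph.index G v ∈ₛ B

Connected : {A : Set} → Rel A 0ℓ → Set
Connected R = ∀ x y → Star R x y

-- The adjacency relation of the subgraph induced by the vertices satisfying P.
Induced : (G : Graph) (P : V G → Set) → Rel (∃ P) 0ℓ
Induced G P s t = Graph.Adj G (proj₁ s) (proj₁ t)

record IsTree (T : Graph) : Set where
  open Graph T hiding (V)
  field
    root      : V T
    connected : Connected Adj
    -- A cycle is a list of at least three distinct vertices, consecutive ones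
    -- adjacent, whose last vertex is adjacent to the first.
    acyclic   : ∀ x y z zs → Unique (x ∷ y ∷ z ∷ zs) →
                ¬ Linked Adj ((x ∷ y ∷ z ∷ zs) ∷ʳ x)

record TreeDecomposition (G : Graph) : Set₁ where
  field
    T      : Graph
    isTree : IsTree T
    bag    : V T → VertexSet G

  Occurs : V G → V T → Set
  Occurs v t = Member G v (bag t)

  field
    vertex-nonempty  : ∀ v → ∃ (Occurs v)
    vertex-connected : ∀ v → Connected (Induced T (Occurs v))
    edge-covered     : ∀ {u v} → Graph.Adj G u v →
                       ∃[ t ] (Occurs u t × Occurs v t)

  -- T has a vertex and cardinalities are non-negative, so the default
  -- value 0 does not affect the maximum.
  width : ℤ
  width = + max 0 (map (λ t → ∣ bag t ∣) (Graph.vertices T)) - 1ℤ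

open TreeDecomposition using (width)

-- "tw(G) = w". Treewidth is given as a (functional) relation because
-- a minimum over all decompositions is not directly computable. Values are
-- integers because the null graph has treewidth -1.
IsTreewidth : Graph → ℤ → Set₁
IsTreewidth G w = (∃[ D ] width {G} D ≡ w) × (∀ D → w ≤ width {G} D)

module _ (G H : Graph) where
  private
    module G = Graph G
    module H = Graph H

  StrongAdj : Rel (G.V × H.V) 0ℓ
  StrongAdj (g₁ , h₁) (g₂ , h₂) =
    (g₁ ≡ g₂ × H.Adj h₁ h₂) ⊎ (G.Adj g₁ g₂ × h₁ ≡ h₂) ⊎ (G.Adj g₁ g₂ × H.Adj h₁ h₂)

  LexAdj : Rel (G.V × H.V) 0ℓ
  LexAdj (g₁ , h₁) (g₂ , h₂) = G.Adj g₁ g₂ ⊎ (g₁ ≡ g₂ × H.Adj h₁ h₂)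

  enum-× : (G.V × H.V) ↔ Fin (G.order * H.order)
  enum-× = ↔-sym *↔× ↔-∘ (G.enum ×-↔ H.enum)

infixl 7 _⊠_ _∘_

_⊠_ : Graph → Graph → Graph
G ⊠ H = record
  { V          = G.V × H.V
  ; order      = G.order * H.order
  ; enum       = enum-× G H
  ; Adj        = StrongAdj G H
  ; adj?       = λ (g₁ , h₁) (g₂ , h₂) →
      (g₁ G.≟ᵥ g₂ ×-dec H.adj? h₁ h₂) ⊎-dec
      (G.adj? g₁ g₂ ×-dec h₁ H.≟ᵥ h₂) ⊎-dec
      (G.adj? g₁ g₂ ×-dec H.adj? h₁ h₂)
  ; adj-sym    = λ where
      (inj₁ (p , b))        → inj₁ (sym p , H.adj-sym b)
      (inj₂ (inj₁ (a , q))) → inj₂ (inj₁ (G.adj-sym a , sym q))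
      (inj₂ (inj₂ (a , b))) → inj₂ (inj₂ (G.adj-sym a , H.adj-sym b))
  ; adj-irrefl = λ where
      refl (inj₁ (_ , b))        → H.adj-irrefl refl b
      refl (inj₂ (inj₁ (a , _))) → G.adj-irrefl refl a
      refl (inj₂ (inj₂ (a , _))) → G.adj-irrefl refl a
  }
  where
  module G = Graph G
  module H = Graph H

_∘_ : Graph → Graph → Graph
G ∘ H = record
  { V          = G.V × H.V
  ; order      = G.order * H.order
  ; enum       = enum-× G H
  ; Adj        = LexAdj G H
  ; adj?       = λ (g₁ , h₁) (g₂ , h₂) →
      G.adj? g₁ g₂ ⊎-dec (g₁ G.≟ᵥ g₂ ×-dec H.adj? h₁ h₂)
  ; adj-sym    = λ where
      (inj₁ a)       → inj₁ (G.adj-sym a)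
      (inj₂ (p , b)) → inj₂ (sym p , H.adj-sym b)
  ; adj-irrefl = λ where
      refl (inj₁ a)       → G.adj-irrefl refl a
      refl (inj₂ (_ , b)) → H.adj-irrefl refl b
  }
  where
  module G = Graph G
  module H = Graph H

{-# OPTIONS --safe #-}
-- For G = K₂ and H edgeless on n vertices, G ⊠ H is n disjoint edges and has
-- treewidth 1, whereas G ∘ H is K_{n,n}.  In a rooted tree-decomposition choose
-- a vertex whose topmost node is as deep as possible: the bag of that node
-- contains all its neighbours, so every tree-decomposition of K_{n,n} has a bag
-- with at least n elements.
module Submission where

open import Defs
open import Data.Empty using (⊥; ⊥-elim)
open import Data.Fin.Base using (Fin; zero; suc; opposite)
open import Data.Fin.Properties using (suc-injective)
open import Data.Fin.Subset
  using (Subset; inside; outside; ∣_∣; ⊤; ⁅_⁆; _∪_) renaming (_∈_ to _∈ₛ_)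
open import Data.Fin.Subset.Properties
  using (_∈?_; ∈⊤; x∈⁅x⁆; x∈⁅y⁆⇒x≡y; ∣⁅x⁆∣≡1; x∈p∪q⁻; x∈p∪q⁺;
         x∈p∧x≢y⇒x∈p-y; x∈p⇒∣p-x∣<∣p∣)
open import Data.Integer.Base using (ℤ; +_; _≤_)
import Data.Integer.Properties as ℤ
open import Data.List.Base using (List; []; _∷_; _++_; _∷ʳ_; length; map; filter)
open import Data.List.Extrema.Nat
  using (max; xs≤max; max≤v⁺; argmin; argmax; argmin-all; f[argmin]≤f[xs]; f[xs]≤f[argmax])
open import Data.List.Membership.Propositional using (_∈_)
open import Data.List.Membership.Propositional.Properties
  using (∈-map⁺; ∈-allFin; ∈-filter⁺; ∈-∃++; ∈-insert)
open import Data.List.Properties using (∷-injectiveʳ)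
open import Data.List.Relation.Unary.All as All using (All; []; _∷_)
import Data.List.Relation.Unary.All.Properties as All
open import Data.List.Relation.Unary.AllPairs using ([]; _∷_)
open import Data.List.Relation.Unary.Any using (here; there)
open import Data.List.Relation.Unary.Linked using (Linked; [-]; _∷_)
open import Data.List.Relation.Unary.Unique.Propositional using (Unique)
open import Data.Nat.Base as ℕ using (ℕ; zero; suc; s≤s; z≤n)
import Data.Nat.Properties as ℕ
open import Data.Nat.Induction using (<-wellFounded)
open import Data.Product.Base using (Σ-syntax; _×_; _,_; ∃; ∃-syntax; proj₁; proj₂)
open import Data.Sum.Base using (_⊎_; inj₁; inj₂)
open import Data.Vec.Base using ([]; _∷_)
open import Data.Vec.Properties.WithK using ([]=-irrelevant)
open import Function.Base using (_$_)
open import Function.Bundles using (Inverse)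
open import Function.Construct.Identity using (↔-id)
open import Induction.WellFounded using (Acc; acc)
open import Relation.Binary.Construct.Closure.ReflexiveTransitive using (Star; ε; _◅_; _◅◅_)
open import Relation.Binary.Core using (Rel)
open import Relation.Binary.PropositionalEquality.Core
  using (_≡_; _≢_; refl; sym; trans; cong; subst; subst₂)
open import Relation.Nullary.Decidable using (yes; no)
open import Relation.Nullary.Negation.Core using (¬_)
open import Level using (0ℓ)

-- Cardinalities of finite subsets.

injection⇒≤∣∣ : ∀ {m n} {S : Subset m} (f : Fin n → Fin m) →
                (∀ {i j} → f i ≡ f j → i ≡ j) → (∀ i → f i ∈ₛ S) → n ℕ.≤ ∣ S ∣
injection⇒≤∣∣ {n = zero}  f inj f∈S = z≤n
-- Deleting `f zero` from `S` keeps all the other images and lowers the cardinality.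
injection⇒≤∣∣ {n = suc n} f inj f∈S = ℕ.≤-<-trans
  (injection⇒≤∣∣ (λ i → f (suc i)) (λ e → suc-injective (inj e))
    (λ i → x∈p∧x≢y⇒x∈p-y (f∈S (suc i)) (λ e → suc≢zero (inj e))))
  (x∈p⇒∣p-x∣<∣p∣ (f∈S zero))
  where
  suc≢zero : ∀ {n} {i : Fin n} → Fin.suc i ≢ zero
  suc≢zero ()

∣p∪q∣≤∣p∣+∣q∣ : ∀ {n} (p q : Subset n) → ∣ p ∪ q ∣ ℕ.≤ ∣ p ∣ ℕ.+ ∣ q ∣
∣p∪q∣≤∣p∣+∣q∣ []            []            = z≤n
∣p∪q∣≤∣p∣+∣q∣ (outside ∷ p) (outside ∷ q) = ∣p∪q∣≤∣p∣+∣q∣ p q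
∣p∪q∣≤∣p∣+∣q∣ (outside ∷ p) (inside  ∷ q) = ℕ.≤-trans (s≤s (∣p∪q∣≤∣p∣+∣q∣ p q))
  (ℕ.≤-reflexive (sym (ℕ.+-suc ∣ p ∣ ∣ q ∣)))
∣p∪q∣≤∣p∣+∣q∣ (inside  ∷ p) (outside ∷ q) = s≤s (∣p∪q∣≤∣p∣+∣q∣ p q)
∣p∪q∣≤∣p∣+∣q∣ (inside  ∷ p) (inside  ∷ q) = s≤s (ℕ.≤-trans (∣p∪q∣≤∣p∣+∣q∣ p q)
  (ℕ.+-monoʳ-≤ ∣ p ∣ (ℕ.n≤1+n ∣ q ∣)))

-- Prefixes and suffixes of lists.

Unique-++⁻ˡ : ∀ {A : Set} (xs : List A) {ys} → Unique (xs ++ ys) → Unique xs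
Unique-++⁻ˡ []       _        = []
Unique-++⁻ˡ (x ∷ xs) (p ∷ ps) = All.++⁻ˡ xs p ∷ Unique-++⁻ˡ xs ps

Linked-∷ʳ⁻ : ∀ {A : Set} {R : Rel A 0ℓ} xs {y ys} → Linked R (xs ++ y ∷ ys) → Linked R (xs ∷ʳ y)
Linked-∷ʳ⁻ []           _       = [-]
Linked-∷ʳ⁻ (x ∷ [])     (r ∷ _) = r ∷ [-]
Linked-∷ʳ⁻ (x ∷ z ∷ xs) (r ∷ l) = r ∷ Linked-∷ʳ⁻ (z ∷ xs) l

-- Both splittings are of one list, and the length bound puts `t` no later than `s`, so `t` lies in
-- `ps` or is `s` itself.
++-overlap : ∀ {A : Set} (P : A → Set) (ps qs : List A) {s t : A} {ss ts : List A} →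
             ps ++ s ∷ ss ≡ qs ++ t ∷ ts → length (s ∷ ss) ℕ.≤ length (t ∷ ts) →
             All P ps → P s → P t
++-overlap P []       []       refl _   _        ps = ps
++-overlap P (p ∷ _)  []       refl _   (pp ∷ _) _  = pp
++-overlap P []       (q ∷ qs) {t = t} {ts = ts} refl s≤t _ _ =
  ⊥-elim (ℕ.<-irrefl refl (ℕ.<-≤-trans (s≤s (tail-≤ qs)) s≤t))
  where
  tail-≤ : ∀ qs → length (t ∷ ts) ℕ.≤ length (qs ++ t ∷ ts)
  tail-≤ []       = ℕ.≤-refl
  tail-≤ (q ∷ qs) = ℕ.m≤n⇒m≤1+n (tail-≤ qs)
++-overlap P (p ∷ ps) (q ∷ qs) e    s≤t (_ ∷ pps) pss =
  ++-overlap P ps qs (∷-injectiveʳ e) s≤t pps pss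

module _ (G : Graph) where
  open Graph G

  index-injective : ∀ {u v} → index u ≡ index v → u ≡ v
  index-injective {u} {v} e = trans (sym (Inverse.strictlyInverseʳ enum u))
    (trans (cong (Inverse.from enum) e) (Inverse.strictlyInverseʳ enum v))

  ∈-vertices : ∀ v → v ∈ vertices
  ∈-vertices v = subst (_∈ vertices) (Inverse.strictlyInverseʳ enum v)
    (∈-map⁺ (Inverse.from enum) (∈-allFin (index v)))

-- Paths to the root of a tree.

module RootedTree {T : Graph} (isTree : IsTree T) where
  open Graph T
  open IsTree isTree

  -- Walks ending at the root that never turn back along the edge just used; every
  -- walk shortens to one of these, and acyclicity makes them simple and unique.
  data Reduced : List V → Set where
    stop : Reduced (root ∷ [])
    edge : ∀ {x} → Adj x root → Reduced (x ∷ root ∷ [])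
    step : ∀ {x y z zs} → Adj x y → x ≢ z → Reduced (y ∷ z ∷ zs) → Reduced (x ∷ y ∷ z ∷ zs)

  reduced-tail : ∀ {x y ys} → Reduced (x ∷ y ∷ ys) → Reduced (y ∷ ys)
  reduced-tail (edge _)     = stop
  reduced-tail (step _ _ r) = r

  reduced-head : ∀ {x y ys} → Reduced (x ∷ y ∷ ys) → Adj x y
  reduced-head (edge a)     = a
  reduced-head (step a _ _) = a

  reduced⇒linked : ∀ {xs} → Reduced xs → Linked Adj xs
  reduced⇒linked stop         = [-]
  reduced⇒linked (edge a)     = a ∷ [-]
  reduced⇒linked (step a _ r) = a ∷ reduced⇒linked r

  -- A return to `x` after one edge is a loop, after two edges it turns back, and after more it
  -- closes a cycle, as the vertices in between are distinct.
  reduced-head∉tail : ∀ {x y ys} → Reduced (x ∷ y ∷ ys) → Unique (y ∷ ys) → ¬ x ∈ y ∷ ys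
  reduced-head∉tail {x} r u x∈ with ∈-∃++ x∈
  ... | [] , _ , refl = adj-irrefl refl (reduced-head r)
  reduced-head∉tail (step _ x≢x _) u x∈ | _ ∷ [] , _ , refl = x≢x refl
  reduced-head∉tail {x} r u x∈ | y ∷ z ∷ zs , _ , refl =
    acyclic x y z zs (x∉ u ∷ Unique-++⁻ˡ (y ∷ z ∷ zs) u)
      (Linked-∷ʳ⁻ (x ∷ y ∷ z ∷ zs) (reduced⇒linked r))
    where
    x∉ : ∀ {ws ys} → Unique (ws ++ x ∷ ys) → All (x ≢_) ws
    x∉ {[]}     _        = []
    x∉ {w ∷ ws} (p ∷ ps) = (λ e → All.lookup p (∈-insert ws) (sym e)) ∷ x∉ ps

  reduced⇒unique : ∀ {xs} → Reduced xs → Unique xs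
  reduced⇒unique stop           = [] ∷ []
  reduced⇒unique r@(edge _)     = All.¬Any⇒All¬ _ (reduced-head∉tail r ([] ∷ [])) ∷ [] ∷ []
  reduced⇒unique r@(step _ _ r′) =
    All.¬Any⇒All¬ _ (reduced-head∉tail r (reduced⇒unique r′)) ∷ reduced⇒unique r′

  -- Every reduced walk ends at the root, so such a walk would repeat its head.
  root-reduced : ∀ {x xs} → ¬ Reduced (root ∷ x ∷ xs)
  root-reduced r = reduced-head∉tail r (reduced⇒unique (reduced-tail r)) (ends (reduced-tail r))
    where
    ends : ∀ {xs} → Reduced xs → root ∈ xs
    ends stop         = here refl
    ends (edge _)     = there (here refl)
    ends (step _ _ r) = there (ends r)

  -- Moving the common start along the first walk lengthens the second one,
  -- until the second walk is a reduced walk from the root to itself.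
  reduced-no-fork : ∀ {x y ys z zs} → y ≢ z → Reduced (x ∷ y ∷ ys) → ¬ Reduced (x ∷ z ∷ zs)
  reduced-no-fork y≢z (edge a)        r = root-reduced (step (adj-sym a) y≢z r)
  reduced-no-fork y≢z (step a x≢w r′) r =
    reduced-no-fork (λ w≡x → x≢w (sym w≡x)) r′ (step (adj-sym a) y≢z r)

  reduced-unique : ∀ {x xs ys} → Reduced (x ∷ xs) → Reduced (x ∷ ys) → xs ≡ ys
  reduced-unique {xs = []}     {[]}     r    r′ = refl
  reduced-unique {xs = []}     {y ∷ ys} stop r′ = ⊥-elim (root-reduced r′)
  reduced-unique {xs = x ∷ xs} {[]}     r  stop = ⊥-elim (root-reduced r)
  reduced-unique {xs = x ∷ xs} {y ∷ ys} r    r′ with x ≟ᵥ y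
  ... | yes refl = cong (x ∷_) (reduced-unique (reduced-tail r) (reduced-tail r′))
  ... | no  x≢y  = ⊥-elim (reduced-no-fork x≢y r r′)

  reduced-extend : ∀ {x y} → Adj x y → ∃[ ys ] Reduced (y ∷ ys) → ∃[ xs ] Reduced (x ∷ xs)
  reduced-extend a ([] , stop) = _ , edge a
  reduced-extend {x} a (z ∷ zs , r) with x ≟ᵥ z
  ... | yes refl = zs , reduced-tail r
  ... | no  x≢z  = _ , step a x≢z r

  reduced-walk : ∀ {x} → Star Adj x root → ∃[ xs ] Reduced (x ∷ xs)
  reduced-walk ε       = [] , stop
  reduced-walk (a ◅ w) = reduced-extend a (reduced-walk w)

  above : V → List V
  above x = proj₁ (reduced-walk (connected x root))

  path : V → List V
  path x = x ∷ above x

  path-reduced : ∀ x → Reduced (path x)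
  path-reduced x = proj₂ (reduced-walk (connected x root))

  -- Prepending `y` to the path of `x` gives a reduced walk unless that path already moves to `y`
  -- first; uniqueness of reduced walks settles both cases.
  path-adj : ∀ {x y} → Adj x y → path y ≡ y ∷ path x ⊎ path x ≡ x ∷ path y
  path-adj {x} {y} a = go (path-reduced x)
    where
    go : ∀ {xs} → Reduced (x ∷ xs) → path y ≡ y ∷ x ∷ xs ⊎ x ∷ xs ≡ x ∷ path y
    go stop = inj₁ (cong (y ∷_) (reduced-unique (path-reduced y) (edge (adj-sym a))))
    go {z ∷ zs} r with y ≟ᵥ z
    ... | yes refl = inj₂ (cong (λ ys → x ∷ y ∷ ys)
      (reduced-unique (reduced-tail r) (path-reduced y)))
    ... | no  y≢z  = inj₁ (cong (y ∷_) (reduced-unique (path-reduced y) (step (adj-sym a) y≢z r)))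

  depth : V → ℕ
  depth x = length (path x)

  -- Each path to the root from a connected set leaves it only through its top.
  path-through-top : ∀ {P : V → Set} {t} → (∀ {x} → P x → depth t ℕ.≤ depth x) →
                     ∀ {s x : ∃ P} → Star (Induced T P) s x →
                     ∃[ xs ] (path (proj₁ s) ≡ xs ++ path t × All P xs) →
                     ∃[ xs ] (path (proj₁ x) ≡ xs ++ path t × All P xs)
  path-through-top t-min ε h = h
  path-through-top {t = t} t-min (_◅_ {s , ps} {y , py} a w) (xs , e , all) =
    path-through-top t-min w (next (path-adj a) xs e all)
    where
    next : path y ≡ y ∷ path s ⊎ path s ≡ s ∷ path y → ∀ xs → path s ≡ xs ++ path t → All _ xs → _
    next (inj₁ up) xs e all = y ∷ xs , trans up (cong (y ∷_) e) , py ∷ all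
    -- Here `s` is `t` and `y` is its parent, hence less deep than `t`.
    next (inj₂ down) [] e all = ⊥-elim $ ℕ.<-irrefl refl $
      ℕ.≤-trans (ℕ.≤-reflexive (cong length (trans (sym down) e))) (t-min py)
    next (inj₂ down) (x ∷ xs) e (_ ∷ all) = xs , ∷-injectiveʳ (trans (sym down) e) , all

-- Topmost nodes in a rooted tree-decomposition.

module _ {G : Graph} (D : TreeDecomposition G) where
  open TreeDecomposition D
  open RootedTree isTree
  private
    module G = Graph G
    module T = Graph T

  -- The default of `argmin` is itself an occurrence of `v`, so the result is one in every case.
  top : G.V → T.V
  top v = argmin depth (proj₁ (vertex-nonempty v))
    (filter (λ t → G.index v ∈? bag t) T.vertices)

  top-occurs : ∀ v → Occurs v (top v)
  top-occurs v = argmin-all depth (proj₂ (vertex-nonempty v))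
    (All.all-filter (λ t → G.index v ∈? bag t) T.vertices)

  top-minimal : ∀ v {t} → Occurs v t → depth (top v) ℕ.≤ depth t
  top-minimal v {t} o = All.lookup (f[argmin]≤f[xs] (proj₁ (vertex-nonempty v)) _)
    (∈-filter⁺ (λ t → G.index v ∈? bag t) (∈-vertices T t) o)

  path-through-top-of : ∀ v {t} → Occurs v t →
                        ∃[ ts ] (path t ≡ ts ++ path (top v) × All (Occurs v) ts)
  path-through-top-of v {t} o = path-through-top (top-minimal v)
    (vertex-connected v (top v , top-occurs v) (t , o)) ([] , refl , [])

  -- From a node whose bag holds both `u` and `v`, the path to the root meets both tops. The deeper
  -- `top v` comes no later than `top u`, and up to `top u` every bag on the path contains `u`.
  adjacent-occurs-at-lower-top : ∀ {u v} → G.Adj u v → depth (top u) ℕ.≤ depth (top v) →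
                                 Occurs u (top v)
  adjacent-occurs-at-lower-top {u} {v} a u≤v with edge-covered a
  ... | t , ou , ov with path-through-top-of u ou | path-through-top-of v ov
  ...   | ps , eu , all | qs , ev , _ =
    ++-overlap (Occurs u) ps qs (trans (sym eu) ev) u≤v all (top-occurs u)

  neighbourhood-in-bag : G.V → ∃[ v ] ∃[ t ] (∀ {u} → G.Adj u v → Occurs u t)
  neighbourhood-in-bag v₀ = v , top v , λ {u} a → adjacent-occurs-at-lower-top a
    (All.lookup (f[xs]≤f[argmax] v₀ G.vertices) (∈-vertices G u))
    where
    v : G.V
    v = argmax (λ u → depth (top u)) v₀ G.vertices

  bagMax : ℕ
  bagMax = max 0 (map (λ t → ∣ bag t ∣) T.vertices)

  bag≤⇒width≤ : ∀ {l} → (∀ t → ∣ bag t ∣ ℕ.≤ suc l) → width ≤ + l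
  -- `width` unfolds to `bagMax ⊖ 1` and `+ l` is `suc l ⊖ 1`, so it suffices to compare before
  -- subtracting.
  bag≤⇒width≤ {l} h = ℤ.⊖-monoˡ-≤ 1 {bagMax} {suc l}
    (max≤v⁺ {xs = map (λ t → ∣ bag t ∣) T.vertices} z≤n (All.map⁺ (All.tabulate λ {t} _ → h t)))

  <bag⇒≤width : ∀ {l t} → l ℕ.< ∣ bag t ∣ → + l ≤ width
  <bag⇒≤width {l} {t} h = ℤ.⊖-monoˡ-≤ 1 {suc l} {bagMax} $ ℕ.≤-trans h
    (All.lookup (xs≤max 0 _) (∈-map⁺ (λ t → ∣ bag t ∣) (∈-vertices T t)))

-- Stars and edgeless graphs.

data StarAdj {n} : Rel (Fin (suc n)) 0ℓ where
  out : ∀ {i} → StarAdj zero (suc i)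
  in′ : ∀ {i} → StarAdj (suc i) zero

-- Serves as a one-node tree (`star 0`), as the factor K₂ (`star 1`) and as the tree of a
-- decomposition.
star : ℕ → Graph
star n = record
  { V          = Fin (suc n)
  ; order      = suc n
  ; enum       = ↔-id _
  ; Adj        = StarAdj
  ; adj?       = λ where
      zero    zero    → no λ ()
      zero    (suc _) → yes out
      (suc _) zero    → yes in′
      (suc _) (suc _) → no λ ()
  ; adj-sym    = λ where
      out → in′
      in′ → out
  ; adj-irrefl = λ where refl ()
  }

star-isTree : ∀ n → IsTree (star n)
star-isTree n = record
  { root      = zero
  ; connected = λ x y → to-centre x ◅◅ from-centre y
  ; acyclic   = acyclic
  }
  where
  to-centre : ∀ x → Star StarAdj x zero
  to-centre zero    = ε
  to-centre (suc _) = in′ ◅ ε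
  from-centre : ∀ x → Star StarAdj zero x
  from-centre zero    = ε
  from-centre (suc _) = out ◅ ε
  acyclic : ∀ x y z zs → Unique (x ∷ y ∷ z ∷ zs) → ¬ Linked StarAdj ((x ∷ y ∷ z ∷ zs) ∷ʳ x)
  -- Edges alternate between centre and leaves, so a closed walk of this length meets the centre
  -- twice or joins two leaves.
  acyclic _ _ _ _        ((_ ∷ x≢z ∷ _) ∷ _)  (out ∷ in′ ∷ _)         = x≢z refl
  acyclic _ _ _ []       _                    (in′ ∷ out ∷ () ∷ _)
  acyclic _ _ _ (_ ∷ _)  (_ ∷ (_ ∷ y≢w ∷ _) ∷ _) (in′ ∷ out ∷ in′ ∷ _) = y≢w refl

edgeless : ℕ → Graph
edgeless n = record
  { V          = Fin n
  ; order      = n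
  ; enum       = ↔-id _
  ; Adj        = λ _ _ → ⊥
  ; adj?       = λ _ _ → no λ ()
  ; adj-sym    = λ ()
  ; adj-irrefl = λ _ ()
  }

induced-connected : ∀ (T : Graph) {n} (B : Graph.V T → Subset n) i →
                    (∀ {s t} → i ∈ₛ B s → i ∈ₛ B t → s ≡ t) →
                    Connected (Induced T (λ t → i ∈ₛ B t))
induced-connected T B i single (s , p) (t , q) with single p q
-- Vertices of the induced subgraph carry membership proofs, which must also agree for the empty
-- walk to fit.
... | refl rewrite []=-irrelevant p q = ε

-- Existence of treewidth.

trivialDecomposition : ∀ G → TreeDecomposition G
trivialDecomposition G = record
  { T                = star 0
  ; isTree           = star-isTree 0
  ; bag              = λ _ → ⊤
  ; vertex-nonempty  = λ v → zero , ∈⊤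
  ; vertex-connected = λ v → induced-connected (star 0) (λ _ → ⊤) (Graph.index G v)
      (λ {s} {t} _ _ → single s t)
  ; edge-covered     = λ _ → zero , ∈⊤ , ∈⊤
  }
  where
  single : (s t : Fin 1) → s ≡ t
  single zero zero = refl

-- If no decomposition were minimal, each would have one with smaller `bagMax`, an infinite descent
-- in ℕ. Double negation avoids deciding minimality and suffices for a negated goal.
¬¬treewidth : ∀ G → ¬ ¬ (∃[ w ] IsTreewidth G w)
¬¬treewidth G none = go (trivialDecomposition G) (<-wellFounded _)
  where
  go : ∀ D → ¬ Acc ℕ._<_ (bagMax {G} D)
  go D (acc rec) = none (TreeDecomposition.width D , (D , refl) , minimal)
    where
    minimal : ∀ D′ → TreeDecomposition.width D ≤ TreeDecomposition.width D′
    minimal D′ with bagMax D ℕ.≤? bagMax D′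
    ... | yes le = ℤ.⊖-monoˡ-≤ 1 {bagMax D} {bagMax D′} le
    ... | no  ≰  = ⊥-elim (go D′ (rec (ℕ.≰⇒> ≰)))

-- Treewidth of a matching.

module Matching (n : ℕ) where
  private
    M : Graph
    M = star 1 ⊠ edgeless (suc n)
    module M = Graph M

  bag : Fin (suc n) → VertexSet M
  bag h = ⁅ M.index (zero , h) ⁆ ∪ ⁅ M.index (suc zero , h) ⁆

  occurs : ∀ g h → Member M (g , h) (bag h)
  occurs zero       h = x∈p∪q⁺ (inj₁ (x∈⁅x⁆ (M.index (zero , h))))
  occurs (suc zero) h = x∈p∪q⁺ (inj₂ (x∈⁅x⁆ (M.index (suc zero , h))))

  occurs⇒≡ : ∀ {g h t} → Member M (g , h) (bag t) → h ≡ t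
  occurs⇒≡ {g} {h} {t} o with x∈p∪q⁻ ⁅ M.index (zero , t) ⁆ ⁅ M.index (suc zero , t) ⁆ o
  ... | inj₁ p = cong proj₂ (index-injective M {g , h} {zero , t}
    (x∈⁅y⁆⇒x≡y (M.index (zero , t)) p))
  ... | inj₂ p = cong proj₂ (index-injective M {g , h} {suc zero , t}
    (x∈⁅y⁆⇒x≡y (M.index (suc zero , t)) p))

  -- The bags are the disjoint edges of the matching, so each vertex occurs at a single node and any
  -- tree on `suc n` nodes would serve.
  decomposition : TreeDecomposition M
  decomposition = record
    { T                = star n
    ; isTree           = star-isTree n
    ; bag              = bag
    ; vertex-nonempty  = λ (g , h) → h , occurs g h
    ; vertex-connected = λ v → induced-connected (star n) bag (M.index v)
        (λ p q → trans (sym (occurs⇒≡ {proj₁ v} {proj₂ v} p)) (occurs⇒≡ {proj₁ v} {proj₂ v} q))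
    ; edge-covered     = covered
    }
    where
    covered : ∀ {u v} → M.Adj u v → ∃[ t ] (Member M u (bag t) × Member M v (bag t))
    -- The other two kinds of strong-product edge require an edge of the edgeless factor.
    covered {g , h} {g′ , _} (inj₂ (inj₁ (_ , refl))) = h , occurs g h , occurs g′ h

  ∣bag∣≤2 : ∀ t → ∣ bag t ∣ ℕ.≤ 2
  ∣bag∣≤2 t = ℕ.≤-trans (∣p∪q∣≤∣p∣+∣q∣ ⁅ M.index (zero , t) ⁆ ⁅ M.index (suc zero , t) ⁆)
    (ℕ.≤-reflexive (subst₂ (λ a b → a ℕ.+ b ≡ 2) (sym (∣⁅x⁆∣≡1 (M.index (zero , t))))
      (sym (∣⁅x⁆∣≡1 (M.index (suc zero , t)))) refl))

  1≤width : ∀ D → + 1 ≤ TreeDecomposition.width {M} D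
  1≤width D with TreeDecomposition.edge-covered D {zero , zero} {suc zero , zero}
                   (inj₂ (inj₁ (out , refl)))
  ... | t , p , q = <bag⇒≤width D {t = t} $ injection⇒≤∣∣ (λ g → M.index (g , zero))
    (λ {g} {g′} e → cong proj₁ (index-injective M {g , zero} {g′ , zero} e)) λ where
      zero       → p
      (suc zero) → q

  treewidth : IsTreewidth M (+ 1)
  treewidth =
    (decomposition ,
     ℤ.≤-antisym (bag≤⇒width≤ decomposition ∣bag∣≤2) (1≤width decomposition)) ,
    1≤width

-- Lower bound for complete bipartite graphs.

star1-opposite : ∀ g → StarAdj {1} (opposite g) g
star1-opposite zero       = in′
star1-opposite (suc zero) = out

-- The bag that holds all neighbours of `(g , _)` contains the whole side over `opposite g`, which
-- has `suc n` vertices.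
completeBipartite-width : ∀ n D → + n ≤ TreeDecomposition.width {star 1 ∘ edgeless (suc n)} D
completeBipartite-width n D = go (neighbourhood-in-bag D (zero , zero))
  where
  K : Graph
  K = star 1 ∘ edgeless (suc n)
  go : (∃[ v ] ∃[ t ] (∀ {u} → Graph.Adj K u v → Member K u (TreeDecomposition.bag D t))) →
       + n ≤ TreeDecomposition.width D
  go ((g , _) , t , covered) = <bag⇒≤width D {t = t} $ injection⇒≤∣∣ opposites
    (λ {i} {j} e → cong proj₂ (index-injective K {opposite g , i} {opposite g , j} e))
    (λ h → covered {opposite g , h} (inj₁ (star1-opposite g)))
    where
    opposites : Fin (suc n) → Fin (Graph.order K)
    opposites h = Graph.index K (opposite g , h)

theorem6 : ¬ (Σ[ f ∈ (ℕ → ℕ) ] ((G H : Graph) (k : ℤ) (l : ℕ) →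
    IsTreewidth (G ∘ H) k → IsTreewidth (G ⊠ H) (+ l) →
    k ≤ + (f l)))
theorem6 (f , bound) = ¬¬treewidth (star 1 ∘ edgeless (suc n)) exceeds
  where
  n : ℕ
  -- The strong product has treewidth 1, so the assumed bound is `f 1`; the lexicographic product is
  -- made to exceed it by one.
  n = suc (f 1)
  exceeds : ¬ (∃[ k ] IsTreewidth (star 1 ∘ edgeless (suc n)) k)
  exceeds (k , tw@((D , refl) , _)) = ℕ.<-irrefl refl $ ℤ.drop‿+≤+ $ ℤ.≤-trans
    (completeBipartite-width n D) (bound (star 1) (edgeless (suc n)) k 1 tw (Matching.treewidth n))
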